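{- Let $(L,\vee,\wedge,0,1)$ be a non-trivial complete lattice, let $(T,R)$ be a time frame with serial relation $R$, let $P,F,H,G\colon L^T\to L^T$ denote the tense operators induced by $(T,R)$, and let $p,q\in L^T$. Then the following hold: (i) $P(0)=F(0)=H(0)=G(0)=0$ and $P(1)=F(1)=H(1)=G(1)=1$; (ii) $p\leq q$ implies $P(p)\leq P(q)$, $F(p)\leq F(q)$, $H(p)\leq H(q)$ and $G(p)\leq G(q)$; (iii) $P(G(q))\leq q\leq G(P(q))$ and $F(H(q))\leq q\leq H(F(q))$.
   Context: A time frame is a pair $(T,R)$ consisting of a non-empty set $T$ and a non-empty binary relation $R\subseteq T\times T$; $s\mathrel R t$ means $(s,t)\in R$. The relation $R$ is serial if for each $s\in T$ there exist $t,u\in T$ with $t\mathrel R s$ and $s\mathrel R u$. Here $0$ and $1$ are the least and greatest elements of $L$; non-trivial means that $L$ has more than one element. $L^T$ is the set of all functions $T\to L$, ordered pointwise; in $L^T$ the symbols $0$ and $1$ denote the constant functions with values $0$ and $1$. The tense operators $P,F,H,G\colon L^T\to L^T$ induced by $(T,R)$ are defined, for $q\in L^T$ and $s\in T$, by $P(q)(s):=\bigvee\{q(t)\mid t\mathrel R s\}$, $F(q)(s):=\bigvee\{q(t)\mid s\mathrel R t\}$, $H(q)(s):=\bigwedge\{q(t)\mid t\mathrel R s\}$, $G(q)(s):=\bigwedge\{q(t)\mid s\mathrel R t\}$. -}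

module Defs where

open import Level using (Level; _⊔_; suc)
open import Data.Product using (_×_; ∃; ∃₂; proj₁)
open import Function using (_∘_; const)
open import Relation.Binary using (Rel; NonEmpty)
open import Relation.Binary.Lattice using (BoundedLattice)
open import Relation.Nullary using (¬_)

private
  variable
    a r c ℓ₁ ℓ₂ : Level

-- Subsets are given as the images of families.  The level i bounds the size of
-- the index types: predicatively, completeness is always relative to such a
-- bound, and quantifying over families rather than predicates on the carrier
-- lets non-trivial instances exist (e.g. Set i ordered by implication).
record CompleteLattice c ℓ₁ ℓ₂ i : Set (suc (c ⊔ ℓ₁ ⊔ ℓ₂ ⊔ i)) where
  field
    boundedLattice : BoundedLattice c ℓ₁ ℓ₂

  open BoundedLattice boundedLattice public

  IsSupremum : {I : Set i} → (I → Carrier) → Carrier → Set (c ⊔ ℓ₂ ⊔ i)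
  IsSupremum f x = (∀ j → f j ≤ x) × (∀ y → (∀ j → f j ≤ y) → x ≤ y)

  IsInfimum : {I : Set i} → (I → Carrier) → Carrier → Set (c ⊔ ℓ₂ ⊔ i)
  IsInfimum f x = (∀ j → x ≤ f j) × (∀ y → (∀ j → y ≤ f j) → y ≤ x)

  field
    ⋁            : {I : Set i} → (I → Carrier) → Carrier
    ⋀            : {I : Set i} → (I → Carrier) → Carrier
    ⋁-isSupremum : {I : Set i} (f : I → Carrier) → IsSupremum f (⋁ f)
    ⋀-isInfimum  : {I : Set i} (f : I → Carrier) → IsInfimum f (⋀ f)

  NonTrivial : Set (c ⊔ ℓ₁)
  NonTrivial = ∃₂ λ x y → ¬ (x ≈ y)

record TimeFrame a r : Set (suc (a ⊔ r)) where
  field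
    T          : Set a
    R          : Rel T r
    T-nonEmpty : T
    R-nonEmpty : NonEmpty R

  Serial : Set (a ⊔ r)
  Serial = ∀ s → ∃₂ λ t u → R t s × R s u

module Tense (𝓛 : CompleteLattice c ℓ₁ ℓ₂ (a ⊔ r)) (𝓣 : TimeFrame a r) where
  open CompleteLattice 𝓛
  open TimeFrame 𝓣

  L^T : Set (c ⊔ a)
  L^T = T → Carrier

  infix 4 _≐_ _⊑_

  _≐_ : Rel L^T (a ⊔ ℓ₁)
  p ≐ q = ∀ t → p t ≈ q t

  _⊑_ : Rel L^T (a ⊔ ℓ₂)
  p ⊑ q = ∀ t → p t ≤ q t

  𝟘 𝟙 : L^T
  𝟘 = const ⊥
  𝟙 = const ⊤

  P F H G : L^T → L^T
  P q s = ⋁ {I = ∃ λ t → R t s} (q ∘ proj₁)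
  F q s = ⋁ {I = ∃ λ t → R s t} (q ∘ proj₁)
  H q s = ⋀ {I = ∃ λ t → R t s} (q ∘ proj₁)
  G q s = ⋀ {I = ∃ λ t → R s t} (q ∘ proj₁)

{-# OPTIONS --safe #-}
-- P ⊣ G and F ⊣ H are adjoint pairs of monotone maps, and (iii) consists of
-- their counits and units.  Seriality makes every join and meet in (i) one of
-- a constant family over an inhabited index type.
module Submission where

open import Level using (Level; _⊔_)
open import Data.Product using (_×_; _,_; proj₁; proj₂)
open import Function using (const)
open import Defs

module CompleteLatticeProperties {c ℓ₁ ℓ₂ i} (𝓛 : CompleteLattice c ℓ₁ ℓ₂ i) where
  open CompleteLattice 𝓛

  private
    variable
      I : Set i

  ⋁-upper : (f : I → Carrier) → ∀ j → f j ≤ ⋁ f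
  ⋁-upper f = proj₁ (⋁-isSupremum f)

  ⋁-least : (f : I → Carrier) → ∀ {x} → (∀ j → f j ≤ x) → ⋁ f ≤ x
  ⋁-least f = proj₂ (⋁-isSupremum f) _

  ⋀-lower : (f : I → Carrier) → ∀ j → ⋀ f ≤ f j
  ⋀-lower f = proj₁ (⋀-isInfimum f)

  ⋀-greatest : (f : I → Carrier) → ∀ {x} → (∀ j → x ≤ f j) → x ≤ ⋀ f
  ⋀-greatest f = proj₂ (⋀-isInfimum f) _

  ⋁-mono : {f g : I → Carrier} → (∀ j → f j ≤ g j) → ⋁ f ≤ ⋁ g
  ⋁-mono f≤g = ⋁-least _ λ j → trans (f≤g j) (⋁-upper _ j)

  ⋀-mono : {f g : I → Carrier} → (∀ j → f j ≤ g j) → ⋀ f ≤ ⋀ g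
  ⋀-mono f≤g = ⋀-greatest _ λ j → trans (⋀-lower _ j) (f≤g j)

  -- The index is needed only for `x` to lie below the join: an empty join would be `⊥`.
  ⋁-const : I → ∀ x → ⋁ {I} (const x) ≈ x
  ⋁-const j x = antisym (⋁-least _ λ _ → refl) (⋁-upper (const x) j)

  -- Dually, the index keeps the meet from being the empty one, which is `⊤`.
  ⋀-const : I → ∀ x → ⋀ {I} (const x) ≈ x
  ⋀-const j x = antisym (⋀-lower (const x) j) (⋀-greatest _ λ _ → refl)

module TenseProperties {c ℓ₁ ℓ₂ a r}
  (𝓛 : CompleteLattice c ℓ₁ ℓ₂ (a ⊔ r)) (𝓣 : TimeFrame a r) where
  open CompleteLattice 𝓛
  open TimeFrame 𝓣
  open Tense {c} {ℓ₁} {ℓ₂} {a} {r} 𝓛 𝓣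
  open CompleteLatticeProperties 𝓛

  module _ (serial : Serial) (x : Carrier) where

    P-const : P (const x) ≐ const x
    P-const s = let t , _ , tRs , _ = serial s in ⋁-const (t , tRs) x

    F-const : F (const x) ≐ const x
    F-const s = let _ , u , _ , sRu = serial s in ⋁-const (u , sRu) x

    H-const : H (const x) ≐ const x
    H-const s = let t , _ , tRs , _ = serial s in ⋀-const (t , tRs) x

    G-const : G (const x) ≐ const x
    G-const s = let _ , u , _ , sRu = serial s in ⋀-const (u , sRu) x

  module _ {p q : L^T} (p⊑q : p ⊑ q) where

    P-mono : P p ⊑ P q
    P-mono s = ⋁-mono λ (t , _) → p⊑q t

    F-mono : F p ⊑ F q
    F-mono s = ⋁-mono λ (t , _) → p⊑q t

    H-mono : H p ⊑ H q
    H-mono s = ⋀-mono λ (t , _) → p⊑q t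

    G-mono : G p ⊑ G q
    G-mono s = ⋀-mono λ (t , _) → p⊑q t

  module _ (q : L^T) where

    -- If `t` precedes `s`, then `s` is among the successors of `t` over which `G q t` is a meet, so
    -- every joinand is at most `q s`.
    PG-counit : P (G q) ⊑ q
    PG-counit s = ⋁-least _ λ (t , tRs) → ⋀-lower _ (s , tRs)

    -- If `t` succeeds `s`, then `s` is a predecessor of `t`, so `q s` is itself a joinand of
    -- `P q t`.
    PG-unit : q ⊑ G (P q)
    PG-unit s = ⋀-greatest _ λ (t , sRt) → ⋁-upper _ (s , sRt)

    -- This and `FH-unit` are the two arguments above for the converse of `R`, which exchanges `P`
    -- with `F` and `G` with `H`.
    FH-counit : F (H q) ⊑ q
    FH-counit s = ⋁-least _ λ (t , sRt) → ⋀-lower _ (s , sRt)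

    FH-unit : q ⊑ H (F q)
    FH-unit s = ⋀-greatest _ λ (t , tRs) → ⋁-upper _ (s , tRs)

theorem3p1 : ∀ {c ℓ₁ ℓ₂ a r : Level}
    (𝓛 : CompleteLattice c ℓ₁ ℓ₂ (a ⊔ r)) → CompleteLattice.NonTrivial 𝓛 →
    (𝓣 : TimeFrame a r) → TimeFrame.Serial 𝓣 →
    let open Tense {c} {ℓ₁} {ℓ₂} {a} {r} 𝓛 𝓣 in
    (p q : L^T) →
    ( ( P 𝟘 ≐ 𝟘 × F 𝟘 ≐ 𝟘 × H 𝟘 ≐ 𝟘 × G 𝟘 ≐ 𝟘 )
    × ( P 𝟙 ≐ 𝟙 × F 𝟙 ≐ 𝟙 × H 𝟙 ≐ 𝟙 × G 𝟙 ≐ 𝟙 ) )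
    × ( p ⊑ q → P p ⊑ P q × F p ⊑ F q × H p ⊑ H q × G p ⊑ G q )
    × ( ( P (G q) ⊑ q × q ⊑ G (P q) )
    × ( F (H q) ⊑ q × q ⊑ H (F q) ) )
theorem3p1 {a = a} {r = r} 𝓛 _ 𝓣 serial p q =
    (constants ⊥ , constants ⊤)
  , (λ p⊑q → P-mono p⊑q , F-mono p⊑q , H-mono p⊑q , G-mono p⊑q)
  , (PG-counit q , PG-unit q)
  , (FH-counit q , FH-unit q)
  where
  open CompleteLattice 𝓛 using (⊥; ⊤)
  open TenseProperties {a = a} {r = r} 𝓛 𝓣
  -- `𝟘` and `𝟙` unfold to `const ⊥` and `const ⊤`, so both halves of (i) are instances of one fact
  -- about an arbitrary `x`.
  constants = λ x → P-const serial x , F-const serial x , H-const serial x , G-const serial x
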